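{- For all integers $n\ge 2$, $eq_n=UT_n$, where $eq_n$ is the number of parking functions $(a_1,\dots,a_n)$ of length $n$ with $a_1=a_2$, and $UT_n$ is the number of edge-labelled trees with label set $\{1,2,\dots,n\}$ on $n+1$ unlabelled vertices.
   Context: A parking function of length $n$ is a sequence $(a_1,\dots,a_n)$ of integers in $\{0,1,\dots,n-1\}$ whose weakly increasing rearrangement $(b_1,\dots,b_n)$ satisfies $b_i<i$ for all $i$. An edge-labelled tree with label set $\{1,\dots,n\}$ on $n+1$ unlabelled vertices is a tree with $n+1$ vertices whose $n$ edges are labelled bijectively by $\{1,\dots,n\}$, counted up to isomorphisms of trees that preserve the edge labels. -}

module Defs where

open import Data.Fin.Base as Fin using (Fin; toℕ; fromℕ; fromℕ<; inject₁)
open import Data.Fin.Permutation as Perm using (Permutation′; _⟨$⟩ʳ_; inverseʳ)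
open import Data.Nat.Base using (ℕ; suc; _+_; _<_; z<s)
open import Data.Nat.Properties using (<-trans)
open import Data.Product.Base using (Σ-syntax; ∃; ∃₂; _×_; _,_; proj₁)
open import Data.Sum.Base using (_⊎_; inj₁; inj₂)
open import Data.Vec.Functional using (Vector)
open import Data.Vec.Functional.Relation.Binary.Permutation using (_↭_)
open import Function.Bundles using (Inverse; Bijection)
open import Function.Definitions using (Injective)
open import Level using (0ℓ; _⊔_) renaming (suc to lsuc)
open import Relation.Binary.Bundles using (Setoid)
open import Relation.Binary.Construct.Closure.ReflexiveTransitive using (Star)
import Relation.Binary.Construct.On as On
open import Relation.Binary.Core using (Rel)
open import Relation.Binary.Definitions
  using (Symmetric; Irreflexive; Decidable; Monotonic₁)
open import Relation.Binary.PropositionalEquality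
  using (_≡_; refl; sym; trans; subst₂; setoid; _→-setoid_)
open import Relation.Nullary.Negation using (¬_)

-- The setoid S has exactly k equivalence classes.
HasCardinality : ∀ {a ℓ} → Setoid a ℓ → ℕ → Set (a ⊔ ℓ)
HasCardinality S k = Inverse S (setoid (Fin k))

-- Positions are 0-indexed, so the entry bᵢ < i of the usual 1-indexed
-- condition becomes b i < i + 1.
IsParkingFunction : ∀ {n} → Vector (Fin n) n → Set
IsParkingFunction {n} a =
  Σ[ b ∈ Vector (Fin n) n ]
    a ↭ b × Monotonic₁ Fin._≤_ Fin._≤_ b × (∀ i → toℕ (b i) < suc (toℕ i))

FirstTwoEqual : ∀ {n} → 1 < n → Vector (Fin n) n → Set
FirstTwoEqual 1<n a = a (fromℕ< (<-trans z<s 1<n)) ≡ a (fromℕ< 1<n)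

-- Elements are compared as sequences; the accompanying proofs are ignored.
EqParkingFunctions : ∀ n → 1 < n → Setoid 0ℓ 0ℓ
EqParkingFunctions n 1<n =
  On.setoid {B = ∃ λ a → IsParkingFunction a × FirstTwoEqual 1<n a}
    (Fin n →-setoid Fin n) proj₁

record Graph (m : ℕ) : Set₁ where
  infix 4 _~_ _~?_
  field
    _~_      : Rel (Fin m) 0ℓ
    _~?_     : Decidable _~_
    ~-sym    : Symmetric _~_
    ~-irrefl : Irreflexive _≡_ _~_

  Connected : Set
  Connected = ∀ u v → Star _~_ u v

  -- A cycle c₀ ~ c₁ ~ ⋯ ~ c₂₊ₖ ~ c₀ on 3 + k distinct vertices.
  record Cycle : Set where
    field
      {k}      : ℕ
      c        : Vector (Fin m) (3 + k)
      distinct : Injective _≡_ _≡_ c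
      step     : ∀ i → c (inject₁ i) ~ c (Fin.suc i)
      close    : c (fromℕ (2 + k)) ~ c Fin.zero

  IsTree : Set
  IsTree = Connected × ¬ Cycle

  SamePair : Fin m × Fin m → Fin m × Fin m → Set
  SamePair (u , v) (u′ , v′) = (u ≡ u′ × v ≡ v′) ⊎ (u ≡ v′ × v ≡ u′)

  -- Edges are unordered: both orientations represent the same edge.
  edges : Setoid 0ℓ 0ℓ
  edges = record
    { Carrier = ∃₂ _~_
    ; _≈_     = λ (u , v , _) (u′ , v′ , _) → SamePair (u , v) (u′ , v′)
    ; isEquivalence = record
      { refl  = inj₁ (refl , refl)
      ; sym   = λ where
          (inj₁ (p , q)) → inj₁ (sym p , sym q)
          (inj₂ (p , q)) → inj₂ (sym q , sym p)
      ; trans = λ where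
          (inj₁ (p , q)) (inj₁ (r , s)) → inj₁ (trans p r , trans q s)
          (inj₁ (p , q)) (inj₂ (r , s)) → inj₂ (trans p r , trans q s)
          (inj₂ (p , q)) (inj₁ (r , s)) → inj₂ (trans p s , trans q r)
          (inj₂ (p , q)) (inj₂ (r , s)) → inj₁ (trans p s , trans q r)
      }
    }

record EdgeLabelledTree (n : ℕ) : Set₁ where
  field
    graph     : Graph (suc n)
    isTree    : Graph.IsTree graph
    labelling : Bijection (Graph.edges graph) (setoid (Fin n))

  open Graph graph public

  label : ∀ {u v} → u ~ v → Fin n
  label {u} {v} e = Bijection.to labelling (u , v , e)

record _≅_ {n} (S T : EdgeLabelledTree n) : Set where
  private
    module S = EdgeLabelledTree S
    module T = EdgeLabelledTree T
  field
    σ         : Permutation′ (suc n)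
    preserves : ∀ {u v} → u S.~ v → (σ ⟨$⟩ʳ u) T.~ (σ ⟨$⟩ʳ v)
    reflects  : ∀ {u v} → (σ ⟨$⟩ʳ u) T.~ (σ ⟨$⟩ʳ v) → u S.~ v
    labels    : ∀ {u v} (e : u S.~ v) (e′ : (σ ⟨$⟩ʳ u) T.~ (σ ⟨$⟩ʳ v)) →
                S.label e ≡ T.label e′

module _ {n : ℕ} where
  open _≅_

  ≅-refl : {S : EdgeLabelledTree n} → S ≅ S
  ≅-refl {S} = record
    { σ         = Perm.id
    ; preserves = λ e → e
    ; reflects  = λ e → e
    ; labels    = λ _ _ → Bijection.cong (EdgeLabelledTree.labelling S) (inj₁ (refl , refl))
    }

  ≅-sym : {S T : EdgeLabelledTree n} → S ≅ T → T ≅ S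
  ≅-sym {S} {T} f = record
    { σ         = Perm.flip (σ f)
    ; preserves = λ e → reflects f
        (subst₂ T._~_ (sym (inverseʳ (σ f))) (sym (inverseʳ (σ f))) e)
    ; reflects  = λ e → subst₂ T._~_ (inverseʳ (σ f)) (inverseʳ (σ f)) (preserves f e)
    ; labels    = λ e e′ → sym (trans (labels f e′ (preserves f e′))
        (Bijection.cong T.labelling (inj₁ (inverseʳ (σ f) , inverseʳ (σ f)))))
    }
    where module T = EdgeLabelledTree T

  ≅-trans : {S T U : EdgeLabelledTree n} → S ≅ T → T ≅ U → S ≅ U
  ≅-trans f g = record
    { σ         = σ f Perm.∘ₚ σ g
    ; preserves = λ e → preserves g (preserves f e)
    ; reflects  = λ e → reflects f (reflects g e)
    ; labels    = λ e e′ → trans (labels f e (preserves f e)) (labels g (preserves f e) e′)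
    }

-- Leaving the vertices unlabelled means comparing trees up to _≅_.
UnlabelledVertexTrees : ℕ → Setoid (lsuc 0ℓ) 0ℓ
UnlabelledVertexTrees n = record
  { Carrier       = EdgeLabelledTree n
  ; _≈_           = _≅_
  ; isEquivalence = record { refl = ≅-refl ; sym = ≅-sym ; trans = ≅-trans }
  }

{-# OPTIONS --safe #-}
module Submission where

-- Root an edge-labelled tree at an end of edge 0 and name the lower end of edge j suc j: the
-- tree becomes a parent function p : Fin n → Fin (suc n) with root zero.  Of the two ends of
-- edge 0 take the one nearer to edge 1; then suc 0 is a child of the root and suc 1 is not
-- below it.  Moving the subtree at suc 0 next to suc 1 turns these parent functions
-- bijectively into those in which suc 0 and suc 1 are siblings.  Finally, replacing each
-- parent by its rank in breadth-first order is a bijection from parent functions to parking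
-- functions: since siblings are visited by increasing label, the order of the vertices is
-- determined by the pairs (rank of the parent , label).  Siblings become equal entries.

open import Defs
open import Data.Bool.Base using (T; true; false; _∧_; _∨_; not)
open import Data.Fin.Base as Fin using
  (Fin; zero; suc; toℕ; fromℕ; fromℕ<; inject₁; inject≤; punchIn; punchOut; finToFun; funToFin)
open import Data.Fin.Permutation as Perm using
  (Permutation′; _⟨$⟩ʳ_; _⟨$⟩ˡ_; permutation; lift₀; inverseˡ; inverseʳ)
open import Data.Fin.Properties as Finₚ using
  ( all?; any?; _≟_; suc-injective; toℕ-injective; toℕ<n; toℕ-fromℕ<; fromℕ<-cong; fromℕ<-injective
  ; toℕ-inject₁; inject₁-injective; toℕ-inject≤; inject≤-injective; punchIn-injective; punchInᵢ≢i
  ; punchOut-injective; injective⇒≤; funToFin-finToFin; finToFun-funToFin )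
open import Data.Fin.Relation.Unary.Top using (view; ‵fromℕ; ‵inject₁)
open import Data.Fin.Subset using (Subset; _∈_; ∣_∣)
open import Data.Fin.Subset.Properties using (∣⊤∣≡n; p⊂q⇒∣p∣<∣q∣; ∈⊤)
open import Data.Nat.Base using (ℕ; zero; suc; _+_; _*_; _≤_; _<_; _<ᵇ_; z≤n; s≤s)
open import Data.Nat.Properties as ℕₚ using
  ( _<?_; _≤?_; <-cmp; <-irrefl; <-asym; <-trans; <⇒≤; <-≤-trans; ≤-refl; ≤-trans; ≤-total
  ; +-cancelˡ-≡; 1+n≰n )
open import Data.Product.Base using (Σ-syntax; ∃; ∃₂; _×_; _,_; proj₁; proj₂)
open import Data.Sum.Base as Sum using (_⊎_; inj₁; inj₂)
open import Data.Vec.Base using (tabulate)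
open import Data.Vec.Functional using (_∷_; tail)
open import Data.Vec.Properties using (lookup∘tabulate; lookup⇒[]=; []=⇒lookup; tabulate-cong)
open import Function.Base using (_∘_)
open import Function.Bundles using (Inverse; Bijection)
import Function.Construct.Composition as Composition
import Function.Construct.Symmetry as Symmetry
open import Function.Definitions using (Injective)
open import Level using (0ℓ)
open import Relation.Binary.Bundles using (Setoid)
open import Relation.Binary.Construct.Closure.ReflexiveTransitive as Star using (Star; ε; _◅_; _◅◅_)
import Relation.Binary.Construct.On as On
open import Relation.Binary.Definitions using (Monotonic₁; tri<; tri≈; tri>)
open import Relation.Binary.PropositionalEquality
open import Relation.Nullary using (¬_; yes; no; contradiction)
open import Relation.Nullary.Decidable using (map′; dec-true; dec-false; _×-dec_; _⊎-dec_)
open import Relation.Unary using (Pred; Decidable)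

private variable m n : ℕ

-- Finite sets and rankings

mkInverse : ∀ {a b ℓ₁ ℓ₂} {S : Setoid a ℓ₁} {T : Setoid b ℓ₂} →
  let module S = Setoid S ; module T = Setoid T in
  (to : S.Carrier → T.Carrier) (from : T.Carrier → S.Carrier) →
  (∀ {x y} → x S.≈ y → to x T.≈ to y) → (∀ {x y} → x T.≈ y → from x S.≈ from y) →
  (∀ y → to (from y) T.≈ y) → (∀ x → from (to x) S.≈ x) → Inverse S T
mkInverse {S = S} {T} to from to-cong from-cong invˡ invʳ = record
  { to = to ; from = from ; to-cong = to-cong ; from-cong = from-cong
  ; inverse = (λ eq → Setoid.trans T (to-cong eq) (invˡ _))
            , (λ eq → Setoid.trans S (from-cong eq) (invʳ _)) }

SubsetSetoid : Pred (Fin n) 0ℓ → Setoid 0ℓ 0ℓ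
SubsetSetoid {n} P = On.setoid {B = ∃ P} (setoid (Fin n)) proj₁

decidable-finite : {P : Pred (Fin n) 0ℓ} → Decidable P → ∃ (HasCardinality (SubsetSetoid P))
decidable-finite {zero} P? = 0 , mkInverse
  (λ { (() , _) }) (λ ()) (λ { {() , _} }) (λ { {()} }) (λ ()) (λ { (() , _) })
decidable-finite {suc n} {P} P? with decidable-finite (P? ∘ suc) | P? zero
... | k , I | yes p₀ = suc k , mkInverse to from (λ {x} {y} → to-cong {x} {y}) (cong (proj₁ ∘ from))
  to-from from-to
  where
  module I = Inverse I

  to : ∃ P → Fin (suc k)
  to (zero  , _) = zero
  to (suc i , p) = suc (I.to (i , p))

  from : Fin (suc k) → ∃ P
  from zero    = zero , p₀
  from (suc j) = suc (proj₁ (I.from j)) , proj₂ (I.from j)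

  to-cong : ∀ {x y} → proj₁ x ≡ proj₁ y → to x ≡ to y
  to-cong {zero  , _} {zero   , _} _    = refl
  to-cong {suc i , _} {suc .i , _} refl = cong suc (I.to-cong refl)

  to-from : ∀ j → to (from j) ≡ j
  to-from zero    = refl
  to-from (suc j) = cong suc (I.inverseˡ refl)

  from-to : ∀ x → proj₁ (from (to x)) ≡ proj₁ x
  from-to (zero  , _) = refl
  from-to (suc i , p) = cong suc (I.inverseʳ refl)
... | k , I | no ¬p₀ = k , mkInverse to from (λ {x} {y} → to-cong {x} {y}) (cong (proj₁ ∘ from))
  (λ _ → I.inverseˡ refl) from-to
  where
  module I = Inverse I

  to : ∃ P → Fin k
  to (zero  , p) = contradiction p ¬p₀
  to (suc i , p) = I.to (i , p)

  from : Fin k → ∃ P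
  from j = suc (proj₁ (I.from j)) , proj₂ (I.from j)

  to-cong : ∀ {x y} → proj₁ x ≡ proj₁ y → to x ≡ to y
  to-cong {zero  , p} {_}          _    = contradiction p ¬p₀
  to-cong {suc i , _} {suc .i , _} refl = I.to-cong refl

  from-to : ∀ x → proj₁ (from (to x)) ≡ proj₁ x
  from-to (zero  , p) = contradiction p ¬p₀
  from-to (suc i , p) = cong suc (I.inverseʳ refl)

FunctionSetoid : Pred (Fin m → Fin n) 0ℓ → Setoid 0ℓ 0ℓ
FunctionSetoid {m} {n} P = On.setoid {B = ∃ P} (Fin m →-setoid Fin n) proj₁

funToFin-cong : {f g : Fin m → Fin n} → f ≗ g → funToFin f ≡ funToFin g
funToFin-cong {zero}  f≗g = refl
funToFin-cong {suc m} f≗g = cong₂ Fin.combine (f≗g zero) (funToFin-cong (f≗g ∘ suc))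

-- Functions are coded in a finite set by `funToFin`. Decoding gives a function back only pointwise,
-- so `P` has to respect `_≗_`.
decidable-functions-finite : {P : Pred (Fin m → Fin n) 0ℓ} →
  (∀ {f g} → f ≗ g → P f → P g) → Decidable P → ∃ (HasCardinality (FunctionSetoid P))
decidable-functions-finite {m} {n} {P} resp P? with decidable-finite (P? ∘ finToFun {n} {m})
... | k , I = k , mkInverse
  (λ (f , p) → I.to (funToFin f , resp (sym ∘ finToFun-funToFin f) p))
  (λ j → finToFun (proj₁ (I.from j)) , proj₂ (I.from j))
  (λ f≗g → I.to-cong (funToFin-cong f≗g))
  (λ { refl _ → refl })
  (λ j → I.inverseˡ (funToFin-finToFin {m} _))
  (λ (f , _) x → trans (cong (λ i → finToFun i x) (I.inverseʳ refl)) (finToFun-funToFin f x))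
  where module I = Inverse I

injective⇒surjective : {f : Fin n → Fin n} → Injective _≡_ _≡_ f → ∀ y → ∃ λ x → f x ≡ y
injective⇒surjective {suc n} {f} inj y with any? (λ x → f x ≟ y)
... | yes hit = hit
... | no miss = contradiction
  (injective⇒≤ {f = λ x → punchOut (y≢f x)} (inj ∘ punchOut-injective (y≢f _) (y≢f _))) 1+n≰n
  where
  y≢f : ∀ x → y ≢ f x
  y≢f x y≡fx = miss (x , sym y≡fx)

injective⇒permutation : (f : Fin n → Fin n) → Injective _≡_ _≡_ f → Permutation′ n
injective⇒permutation f inj = permutation f (proj₁ ∘ surj) (proj₂ ∘ surj) (λ x → inj (proj₂ (surj (f x))))
  where surj = injective⇒surjective inj

permutation-injective : (π : Permutation′ n) → Injective _≡_ _≡_ (π ⟨$⟩ʳ_)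
permutation-injective π {x} {y} eq = trans (sym (inverseˡ π)) (trans (cong (π ⟨$⟩ˡ_) eq) (inverseˡ π))

<ᵇ-true : ∀ {x y} → x < y → (x <ᵇ y) ≡ true
<ᵇ-true {x} {y} = dec-true (x <? y)

<ᵇ-false : ∀ {x y} → y ≤ x → (x <ᵇ y) ≡ false
<ᵇ-false {x} {y} y≤x = dec-false (x <? y) (ℕₚ.≤⇒≯ y≤x)

<ᵇ-reflects : ∀ {x y} → (x <ᵇ y) ≡ true → x < y
<ᵇ-reflects {x} {y} eq = ℕₚ.<ᵇ⇒< x y (subst T (sym eq) _)

infix 4 _∼_

-- Ranks depend on a weight only through the order it induces. Equality of Boolean comparisons turns
-- transfer between weights into plain congruence, as in `position-cong` and `lex-agree`.
record _∼_ {A : Set} (f g : A → ℕ) : Set where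
  constructor sameOrder
  field agree : ∀ x y → (f x <ᵇ f y) ≡ (g x <ᵇ g y)

open _∼_

∼-sym : {A : Set} {f g : A → ℕ} → f ∼ g → g ∼ f
∼-sym f∼g .agree x y = sym (agree f∼g x y)

∼-trans : {A : Set} {f g h : A → ℕ} → f ∼ g → g ∼ h → f ∼ h
∼-trans f∼g g∼h .agree x y = trans (agree f∼g x y) (agree g∼h x y)

≗⇒∼ : {A : Set} {f g : A → ℕ} → f ≗ g → f ∼ g
≗⇒∼ f≗g .agree x y = cong₂ _<ᵇ_ (f≗g x) (f≗g y)

∼-∘ : {A B : Set} {f g : A → ℕ} → f ∼ g → (h : B → A) → (f ∘ h) ∼ (g ∘ h)
∼-∘ f∼g h .agree x y = agree f∼g (h x) (h y)

∼⇒mono : {A : Set} {f g : A → ℕ} → f ∼ g → ∀ {x y} → f x < f y → g x < g y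
∼⇒mono f∼g {x} {y} lt = <ᵇ-reflects (trans (sym (agree f∼g x y)) (<ᵇ-true lt))

module Ranking (κ : Fin n → ℕ) where

  below : Fin n → Subset n
  below i = tabulate (λ j → κ j <ᵇ κ i)

  ∈-below : ∀ {i j} → κ j < κ i → j ∈ below i
  ∈-below {i} {j} lt = lookup⇒[]= j (below i) (trans (lookup∘tabulate _ j) (<ᵇ-true lt))

  below-∈ : ∀ {i j} → j ∈ below i → κ j < κ i
  below-∈ {i} {j} j∈ = <ᵇ-reflects (trans (sym (lookup∘tabulate _ j)) ([]=⇒lookup j∈))

  below-< : ∀ i → ∣ below i ∣ < n
  below-< i = subst (∣ below i ∣ <_) (∣⊤∣≡n n)
    (p⊂q⇒∣p∣<∣q∣ ((λ _ → ∈⊤) , i , ∈⊤ , <-irrefl refl ∘ below-∈))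

  position : Fin n → Fin n
  position i = fromℕ< (below-< i)

  position-mono : ∀ {i j} → κ i < κ j → toℕ (position i) < toℕ (position j)
  position-mono {i} {j} lt rewrite toℕ-fromℕ< (below-< i) | toℕ-fromℕ< (below-< j) =
    p⊂q⇒∣p∣<∣q∣ ((λ x∈ → ∈-below (<-trans (below-∈ x∈) lt)) , i , ∈-below lt , <-irrefl refl ∘ below-∈)

  module _ (κ-injective : Injective _≡_ _≡_ κ) where

    position-injective : Injective _≡_ _≡_ position
    position-injective {i} {j} eq with <-cmp (κ i) (κ j)
    ... | tri< lt _ _ = contradiction (position-mono lt) (<-irrefl (cong toℕ eq))
    ... | tri≈ _ eq′ _ = κ-injective eq′
    ... | tri> _ _ gt = contradiction (position-mono gt) (<-irrefl (cong toℕ (sym eq)))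

    ranking : Permutation′ n
    ranking = injective⇒permutation position position-injective

    ranking-∼ : (toℕ ∘ position) ∼ κ
    ranking-∼ .agree i j with <-cmp (κ i) (κ j)
    ... | tri< lt _ _ = trans (<ᵇ-true (position-mono lt)) (sym (<ᵇ-true lt))
    ... | tri≈ _ eq _ rewrite κ-injective eq =
      trans (<ᵇ-false {toℕ (position j)} ≤-refl) (sym (<ᵇ-false {κ j} ≤-refl))
    ... | tri> _ _ gt = trans (<ᵇ-false (<⇒≤ (position-mono gt))) (sym (<ᵇ-false (<⇒≤ gt)))

open Ranking using (position; ranking; ranking-∼)

position-cong : {f g : Fin n → ℕ} → f ∼ g → position f ≗ position g
position-cong {f = f} {g} f∼g i =
  fromℕ<-cong _ _ (cong ∣_∣ (tabulate-cong (λ j → agree f∼g j i)))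
    (Ranking.below-< f i) (Ranking.below-< g i)

-- Parking functions and parent functions

-- As `toℕ j < n`, this number encodes the pair (`w j`, `j`) in lexicographic order: ties of weight
-- are broken by index.
lex : (Fin n → ℕ) → Fin n → ℕ
lex {n} w j = w j * n + toℕ j

lex-mono : (w : Fin n → ℕ) → ∀ {i j} → w i < w j → lex w i < lex w j
lex-mono {n} w {i} {j} lt = begin-strict
  w i * n + toℕ i <⟨ ℕₚ.+-monoʳ-< (w i * n) (toℕ<n i) ⟩
  w i * n + n     ≡⟨ ℕₚ.+-comm (w i * n) n ⟩
  suc (w i) * n   ≤⟨ ℕₚ.*-monoˡ-≤ n lt ⟩
  w j * n         ≤⟨ ℕₚ.m≤m+n _ _ ⟩
  w j * n + toℕ j ∎
  where open ℕₚ.≤-Reasoning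

lex-injective : (w : Fin n → ℕ) → Injective _≡_ _≡_ (lex w)
lex-injective {n} w {i} {j} eq with <-cmp (w i) (w j)
... | tri< lt _ _ = contradiction (lex-mono w lt) (<-irrefl eq)
... | tri≈ _ wi≡wj _ rewrite wi≡wj = toℕ-injective (+-cancelˡ-≡ (w j * n) _ _ eq)
... | tri> _ _ gt = contradiction (lex-mono w gt) (<-irrefl (sym eq))

lex-<ᵇ : (w : Fin n → ℕ) → ∀ i j →
  (lex w i <ᵇ lex w j) ≡ (w i <ᵇ w j) ∨ (not (w j <ᵇ w i) ∧ (toℕ i <ᵇ toℕ j))
lex-<ᵇ {n} w i j with <-cmp (w i) (w j)
... | tri< lt _ _ rewrite <ᵇ-true lt = <ᵇ-true (lex-mono w lt)
... | tri> _ _ gt rewrite <ᵇ-true gt | <ᵇ-false (<⇒≤ gt) = <ᵇ-false (<⇒≤ (lex-mono w gt))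
... | tri≈ _ eq _ rewrite eq | <ᵇ-false {w j} ≤-refl = shifted (w j * n)
  where
  shifted : ∀ c → (c + toℕ i <ᵇ c + toℕ j) ≡ (toℕ i <ᵇ toℕ j)
  shifted zero    = refl
  shifted (suc c) = shifted c

lex-agree : (w w′ : Fin n → ℕ) (i j : Fin n) →
  (w i <ᵇ w j) ≡ (w′ i <ᵇ w′ j) → (w j <ᵇ w i) ≡ (w′ j <ᵇ w′ i) →
  (lex w i <ᵇ lex w j) ≡ (lex w′ i <ᵇ lex w′ j)
lex-agree w w′ i j eq eq′ = trans (lex-<ᵇ w i j) (trans
  (cong₂ (λ b c → b ∨ (not c ∧ (toℕ i <ᵇ toℕ j))) eq eq′) (sym (lex-<ᵇ w′ i j)))

lex-∼ : {w w′ : Fin n → ℕ} → w ∼ w′ → lex w ∼ lex w′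
lex-∼ {w = w} {w′} w∼w′ .agree i j = lex-agree w w′ i j (agree w∼w′ i j) (agree w∼w′ j i)

extend : (Fin n → ℕ) → Fin (suc n) → ℕ
extend f zero    = 0
extend f (suc j) = suc (f j)

-- The visiting order: the root first, then each `suc j` by (`w j`, `j`). The weight `w` is the key
-- of the parent on the tree side and the entry on the parking side; the two orders coincide once
-- these weights are related by `_∼_`.
vertexRank : (Fin n → ℕ) → Permutation′ (suc n)
vertexRank w = lift₀ (ranking (lex w) (lex-injective w))

vertexRank-∼ : (w : Fin n → ℕ) → (toℕ ∘ (vertexRank w ⟨$⟩ʳ_)) ∼ extend (lex w)
vertexRank-∼ w .agree zero    zero    = refl
vertexRank-∼ w .agree zero    (suc j) = refl
vertexRank-∼ w .agree (suc i) zero    = refl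
vertexRank-∼ w .agree (suc i) (suc j) = agree (ranking-∼ (lex w) (lex-injective w)) i j

vertexRank-cong : {w w′ : Fin n → ℕ} → w ∼ w′ → ∀ v → vertexRank w ⟨$⟩ʳ v ≡ vertexRank w′ ⟨$⟩ʳ v
vertexRank-cong w∼w′ zero    = refl
vertexRank-cong w∼w′ (suc j) = cong suc (position-cong (lex-∼ w∼w′) j)

data Reach (p : Fin n → Fin (suc n)) : Fin (suc n) → Set where
  root : Reach p zero
  step : ∀ {j} → Reach p (p j) → Reach p (suc j)

Acyclic : Pred (Fin n → Fin (suc n)) 0ℓ
Acyclic p = ∀ v → Reach p v

Reach-irrelevant : ∀ {p : Fin n → Fin (suc n)} {v} (r s : Reach p v) → r ≡ s
Reach-irrelevant root     root     = refl
Reach-irrelevant (step r) (step s) = cong step (Reach-irrelevant r s)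

descent⇒acyclic : {p : Fin n → Fin (suc n)} (d : Fin (suc n) → ℕ) →
  (∀ j → d (p j) < d (suc j)) → Acyclic p
descent⇒acyclic {p = p} d desc v = go (suc (d v)) v ≤-refl
  where
  go : ∀ b v → d v < b → Reach p v
  go (suc b) zero    _  = root
  go (suc b) (suc j) (s≤s lt) = step (go b (p j) (<-≤-trans (desc j) lt))

-- The labels on the path from the root to v, read as digits: comparing keys compares
-- vertices in breadth-first order.
pathKey : {p : Fin n → Fin (suc n)} → ∀ {v} → Reach p v → ℕ
pathKey root             = 0
pathKey {n} (step {j} r) = suc (pathKey r * n + toℕ j)

module BreadthFirst {p : Fin n → Fin (suc n)} (acyclic : Acyclic p) where

  key : Fin (suc n) → ℕ
  key v = pathKey (acyclic v)

  -- The proof `acyclic (suc j)` need not be `step (acyclic (p j))`; as `Reach` is proof-irrelevant,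
  -- the key still unfolds by one step.
  key-unfold : key ≗ extend (lex (key ∘ p))
  key-unfold v = trans (cong pathKey (Reach-irrelevant (acyclic v) (unfold v))) (computes v)
    where
    unfold : ∀ v → Reach p v
    unfold zero    = root
    unfold (suc j) = step (acyclic (p j))
    computes : ∀ v → pathKey (unfold v) ≡ extend (lex (key ∘ p)) v
    computes zero    = refl
    computes (suc j) = refl

  key-parent : ∀ j → key (p j) < key (suc j)
  key-parent j rewrite key-unfold (suc j) =
    s≤s (≤-trans (ℕₚ.m≤m*n (key (p j)) n) (ℕₚ.m≤m+n _ (toℕ j)))
    where instance _ = Finₚ.nonZeroIndex j

  rank : Permutation′ (suc n)
  rank = vertexRank (key ∘ p)

  rank-∼-key : (toℕ ∘ (rank ⟨$⟩ʳ_)) ∼ key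
  rank-∼-key = ∼-trans (vertexRank-∼ (key ∘ p)) (∼-sym (≗⇒∼ key-unfold))

  -- A parent has a smaller key, hence a smaller rank, and the right-hand side is the rank of
  -- `suc j`. This becomes the inequality of `Parks`.
  rank-parent : ∀ j → toℕ (rank ⟨$⟩ʳ p j) < suc (toℕ (position (lex (key ∘ p)) j))
  rank-parent j = ∼⇒mono (∼-sym rank-∼-key) (key-parent j)

  rank-parent-< : ∀ j → toℕ (rank ⟨$⟩ʳ p j) < n
  rank-parent-< j = <-≤-trans (rank-parent j) (toℕ<n (position (lex (key ∘ p)) j))

  parentRank : Fin n → Fin n
  parentRank j = fromℕ< (rank-parent-< j)

  parentRank-∼ : (toℕ ∘ parentRank) ∼ (key ∘ p)
  parentRank-∼ = ∼-trans (≗⇒∼ (λ j → toℕ-fromℕ< (rank-parent-< j))) (∼-∘ rank-∼-key p)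

  parentRank-inject₁ : ∀ j → inject₁ (parentRank j) ≡ rank ⟨$⟩ʳ p j
  parentRank-inject₁ j = toℕ-injective (trans (toℕ-inject₁ _) (toℕ-fromℕ< (rank-parent-< j)))

-- The parking condition read off the stable sort: `position` is the 0-indexed place where `j`
-- lands, so the bound by the successor becomes `_≤_`. No rearrangement has to be supplied, which
-- makes the condition decidable.
Parks : Pred (Fin n → Fin n) 0ℓ
Parks a = ∀ j → toℕ (a j) ≤ toℕ (position (lex (toℕ ∘ a)) j)

parentRank-parks : {p : Fin n → Fin (suc n)} (acyclic : Acyclic p) → Parks (BreadthFirst.parentRank acyclic)
parentRank-parks {p = p} acyclic j = subst₂ _≤_ (sym (toℕ-fromℕ< (rank-parent-< j)))
  (cong toℕ (sym (position-cong (lex-∼ parentRank-∼) j)))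
  (ℕₚ.≤-pred (rank-parent j))
  where open BreadthFirst acyclic

module ParkingTree (a : Fin n → Fin n) where

  rank : Permutation′ (suc n)
  rank = vertexRank (toℕ ∘ a)

  parent : Fin n → Fin (suc n)
  parent j = rank ⟨$⟩ˡ inject₁ (a j)

  rank-parent : ∀ j → toℕ (rank ⟨$⟩ʳ parent j) ≡ toℕ (a j)
  rank-parent j = trans (cong toℕ (inverseʳ rank)) (toℕ-inject₁ (a j))

  module _ (parks : Parks a) where

    parent-acyclic : Acyclic parent
    parent-acyclic = descent⇒acyclic (toℕ ∘ (rank ⟨$⟩ʳ_))
      (λ j → subst (_< toℕ (rank ⟨$⟩ʳ suc j)) (sym (rank-parent j)) (s≤s (parks j)))

    open BreadthFirst parent-acyclic using (key; key-unfold; parentRank; parentRank-inject₁)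

    -- Simultaneous induction on the paths from two vertices to the root. Comparing two children
    -- reduces to comparing their parents, and by `rank-parent` the ranks of the parents are the
    -- entries of `a`.
    key-∼-rank : key ∼ (toℕ ∘ (rank ⟨$⟩ʳ_))
    key-∼-rank = ∼-trans (≗⇒∼ key-unfold)
      (∼-trans (sameOrder λ x y → agrees (parent-acyclic x) (parent-acyclic y))
        (∼-sym (vertexRank-∼ (toℕ ∘ a))))
      where
      K L : Fin (suc n) → ℕ
      K = extend (lex (key ∘ parent))
      L = extend (lex (toℕ ∘ a))

      agrees : ∀ {x y} → Reach parent x → Reach parent y → (K x <ᵇ K y) ≡ (L x <ᵇ L y)

      agrees-parents : ∀ {i j} → Reach parent (parent i) → Reach parent (parent j) →
        (key (parent i) <ᵇ key (parent j)) ≡ (toℕ (a i) <ᵇ toℕ (a j))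
      agrees-parents {i} {j} r s = trans (agree (≗⇒∼ key-unfold) (parent i) (parent j)) (trans (agrees r s)
        (trans (sym (agree (vertexRank-∼ (toℕ ∘ a)) (parent i) (parent j)))
          (cong₂ _<ᵇ_ (rank-parent i) (rank-parent j))))

      agrees root     root     = refl
      agrees root     (step _) = refl
      agrees (step _) root     = refl
      agrees (step {i} r) (step {j} s) =
        lex-agree (key ∘ parent) (toℕ ∘ a) i j (agrees-parents r s) (agrees-parents s r)

    key-parent-∼ : (key ∘ parent) ∼ (toℕ ∘ a)
    key-parent-∼ = ∼-trans (∼-∘ key-∼-rank parent) (≗⇒∼ rank-parent)

    parentRank-parent : parentRank ≗ a
    parentRank-parent j = toℕ-injective (begin
      toℕ (parentRank j)           ≡⟨ toℕ-inject₁ _ ⟨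
      toℕ (inject₁ (parentRank j)) ≡⟨ cong toℕ (parentRank-inject₁ j) ⟩
      toℕ (bfsRank ⟨$⟩ʳ parent j)  ≡⟨ cong toℕ (vertexRank-cong key-parent-∼ (parent j)) ⟩
      toℕ (rank ⟨$⟩ʳ parent j)     ≡⟨ rank-parent j ⟩
      toℕ (a j)                    ∎)
      where
      open ≡-Reasoning
      bfsRank = BreadthFirst.rank parent-acyclic

-- By `parentRank-∼`, the entries and the keys of the parents induce the same vertex order, so
-- decoding inverts the very permutation used for encoding.
parent-parentRank : {p : Fin n → Fin (suc n)} (acyclic : Acyclic p) →
  ParkingTree.parent (BreadthFirst.parentRank acyclic) ≗ p
parent-parentRank {p = p} acyclic j = permutation-injective (ParkingTree.rank parentRank) (begin
  R ⟨$⟩ʳ (R ⟨$⟩ˡ inject₁ (parentRank j)) ≡⟨ inverseʳ R ⟩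
  inject₁ (parentRank j)                 ≡⟨ parentRank-inject₁ j ⟩
  rank ⟨$⟩ʳ p j                          ≡⟨ vertexRank-cong parentRank-∼ (p j) ⟨
  R ⟨$⟩ʳ p j                             ∎)
  where
  open BreadthFirst acyclic
  open ≡-Reasoning
  R = ParkingTree.rank parentRank

parentRank-cong : {p q : Fin n → Fin (suc n)} (acyclic-p : Acyclic p) (acyclic-q : Acyclic q) → p ≗ q →
  BreadthFirst.parentRank acyclic-p ≗ BreadthFirst.parentRank acyclic-q
parentRank-cong {p = p} {q} acyclic-p acyclic-q p≗q j = toℕ-injective (begin
  toℕ (P.parentRank j)   ≡⟨ toℕ-fromℕ< (P.rank-parent-< j) ⟩
  toℕ (P.rank ⟨$⟩ʳ p j)  ≡⟨ cong toℕ (vertexRank-cong (≗⇒∼ λ i → key≡ i) (p j)) ⟩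
  toℕ (Q.rank ⟨$⟩ʳ p j)  ≡⟨ cong (λ v → toℕ (Q.rank ⟨$⟩ʳ v)) (p≗q j) ⟩
  toℕ (Q.rank ⟨$⟩ʳ q j)  ≡⟨ toℕ-fromℕ< (Q.rank-parent-< j) ⟨
  toℕ (Q.parentRank j)   ∎)
  where
  open ≡-Reasoning
  module P = BreadthFirst acyclic-p
  module Q = BreadthFirst acyclic-q
  pathKey≡ : ∀ {v} (r : Reach p v) (s : Reach q v) → pathKey r ≡ pathKey s
  pathKey≡ root     root     = refl
  pathKey≡ {suc i} (step r) (step s) = cong (λ k → suc (k * _ + toℕ i))
    (go r (p≗q i) s)
    where
    go : ∀ {u v} (r : Reach p u) → u ≡ v → (s : Reach q v) → pathKey r ≡ pathKey s
    go r refl s = pathKey≡ r s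
  key≡ : P.key ∘ p ≗ Q.key ∘ q
  key≡ i = trans (cong P.key (p≗q i)) (pathKey≡ (acyclic-p (q i)) (acyclic-q (q i)))

-- The increasing rearrangement is `a` composed with the inverse of its stable ranking.
Parks⇒IsParkingFunction : {a : Fin n → Fin n} → Parks a → IsParkingFunction a
Parks⇒IsParkingFunction {n} {a} parks = a ∘ (π ⟨$⟩ˡ_) , (Perm.flip π , λ _ → refl) , mono , bound
  where
  π : Permutation′ n
  π = ranking (lex (toℕ ∘ a)) (lex-injective (toℕ ∘ a))
  bound : ∀ i → toℕ (a (π ⟨$⟩ˡ i)) < suc (toℕ i)
  bound i = s≤s (subst (λ k → toℕ (a (π ⟨$⟩ˡ i)) ≤ toℕ k) (inverseʳ π) (parks (π ⟨$⟩ˡ i)))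
  mono : Monotonic₁ Fin._≤_ Fin._≤_ (a ∘ (π ⟨$⟩ˡ_))
  mono {i} {j} i≤j = ℕₚ.≮⇒≥ λ aj<ai → ℕₚ.<⇒≱ (subst₂ (λ k l → toℕ k < toℕ l) (inverseʳ π) (inverseʳ π)
    (Ranking.position-mono (lex (toℕ ∘ a)) (lex-mono (toℕ ∘ a) aj<ai))) i≤j

-- If a j = suc c, then the entries b i with i ≤ c all satisfy b i ≤ b c ≤ c < a j, so that
-- at least suc c positions are ranked before j.
IsParkingFunction⇒Parks : {a : Fin n → Fin n} → IsParkingFunction a → Parks a
IsParkingFunction⇒Parks {n} {a} (b , (π , aπ≗b) , mono , bound) j = go (toℕ (a j)) refl
  where
  w : Fin n → ℕ
  w = toℕ ∘ a
  pos : Fin n → Fin n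
  pos = position (lex w)
  go : ∀ c → w j ≡ c → c ≤ toℕ (pos j)
  go zero    _  = z≤n
  go (suc c) aj = injective⇒≤ {f = earlier} earlier-injective
   where
   c<n : suc c < n
   c<n = subst (_< n) aj (toℕ<n (a j))
   index : Fin (suc c) → Fin n
   index i = inject≤ i (<⇒≤ c<n)
   earlier-< : ∀ i → toℕ (pos (π ⟨$⟩ʳ index i)) < toℕ (pos j)
   earlier-< i = Ranking.position-mono (lex w) (lex-mono w (begin-strict
     toℕ (a (π ⟨$⟩ʳ index i)) ≡⟨ cong toℕ (aπ≗b (index i)) ⟩
     toℕ (b (index i))        ≤⟨ mono index≤last ⟩
     toℕ (b last)             <⟨ bound last ⟩
     suc (toℕ last)           ≡⟨ cong suc (toℕ-fromℕ< (<⇒≤ c<n)) ⟩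
     suc c                    ≡⟨ aj ⟨
     w j                      ∎))
     where
     open ℕₚ.≤-Reasoning
     last : Fin n
     last = fromℕ< (<⇒≤ c<n)
     index≤last : toℕ (index i) ≤ toℕ last
     index≤last = subst₂ _≤_ (sym (toℕ-inject≤ i _)) (sym (toℕ-fromℕ< _)) (ℕₚ.≤-pred (toℕ<n i))
   earlier : Fin (suc c) → Fin (toℕ (pos j))
   earlier i = fromℕ< (earlier-< i)
   earlier-injective : Injective _≡_ _≡_ earlier
   earlier-injective {i} {i′} eq = inject≤-injective _ _ _ _ (permutation-injective π
     (Ranking.position-injective (lex w) (lex-injective w) (toℕ-injective
       (fromℕ<-injective _ _ (earlier-< i) (earlier-< i′) eq))))

parks? : Decidable (Parks {n})
parks? a = all? (λ j → _ ≤? _)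

IsParkingFunction-resp : {a a′ : Fin n → Fin n} → a ≗ a′ → IsParkingFunction a → IsParkingFunction a′
IsParkingFunction-resp a≗a′ (b , (π , aπ≗b) , rest) =
  b , (π , λ i → trans (sym (a≗a′ _)) (aπ≗b i)) , rest

parent-cong : {a b : Fin n → Fin n} → a ≗ b → ParkingTree.parent a ≗ ParkingTree.parent b
parent-cong {a = a} {b} a≗b j = permutation-injective (rank b) (toℕ-injective (begin
  toℕ (rank b ⟨$⟩ʳ parent a j) ≡⟨ cong toℕ (vertexRank-cong (≗⇒∼ (λ i → cong toℕ (a≗b i))) (parent a j)) ⟨
  toℕ (rank a ⟨$⟩ʳ parent a j) ≡⟨ rank-parent a j ⟩
  toℕ (a j)                    ≡⟨ cong toℕ (a≗b j) ⟩
  toℕ (b j)                    ≡⟨ rank-parent b j ⟨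
  toℕ (rank b ⟨$⟩ʳ parent b j) ∎))
  where
  open ParkingTree
  open ≡-Reasoning

parentRank-siblings : {p : Fin n → Fin (suc n)} (acyclic : Acyclic p) → ∀ {i j} → p i ≡ p j →
  BreadthFirst.parentRank acyclic i ≡ BreadthFirst.parentRank acyclic j
parentRank-siblings acyclic {i} {j} eq = inject₁-injective (trans (parentRank-inject₁ i)
  (trans (cong (rank ⟨$⟩ʳ_) eq) (sym (parentRank-inject₁ j))))
  where open BreadthFirst acyclic

parking↔siblings : (i j : Fin n) →
  Inverse (FunctionSetoid {n} {n} λ a → IsParkingFunction a × a i ≡ a j)
          (FunctionSetoid {n} {suc n} λ p → Acyclic p × p i ≡ p j)
parking↔siblings i j = mkInverse
  (λ (a , pf , eq) → parent a , parent-acyclic a (IsParkingFunction⇒Parks pf) ,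
     cong (λ k → rank a ⟨$⟩ˡ inject₁ k) eq)
  (λ (p , acyclic , eq) → parentRank acyclic , Parks⇒IsParkingFunction (parentRank-parks acyclic) ,
     parentRank-siblings acyclic eq)
  parent-cong
  (λ {(_ , acyclic-p , _)} {(_ , acyclic-q , _)} → parentRank-cong acyclic-p acyclic-q)
  (λ (_ , acyclic , _) → parent-parentRank acyclic)
  (λ (a , pf , _) → parentRank-parent a (IsParkingFunction⇒Parks pf))
  where
  open ParkingTree
  open BreadthFirst using (parentRank)

-- Edge-labelled trees and parent functions

-- The path from a vertex to the root does not meet the vertex suc zero.
data Avoids (p : Fin (suc n) → Fin (suc (suc n))) : Fin (suc (suc n)) → Set where
  root : Avoids p zero
  step : ∀ {j} → Avoids p (p (suc j)) → Avoids p (suc (suc j))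

avoids-parent : {p : Fin (suc n) → Fin (2 + n)} → ∀ {j} → Avoids p (suc (suc j)) → Avoids p (p (suc j))
avoids-parent (step a) = a

-- The last two conditions say that the root is the end of edge 0 nearer to edge 1; this singles out
-- one parent function per isomorphism class.
Normal : Pred (Fin (2 + m) → Fin (3 + m)) 0ℓ
Normal p = Acyclic p × p zero ≡ zero × Avoids p (suc (suc zero))

Sibling : Pred (Fin (2 + m) → Fin (3 + m)) 0ℓ
Sibling p = Acyclic p × p zero ≡ p (suc zero)

graft : (Fin (2 + m) → Fin (3 + m)) → Fin (2 + m) → Fin (3 + m)
graft p = p (suc zero) ∷ tail p

prune : (Fin (2 + m) → Fin (3 + m)) → Fin (2 + m) → Fin (3 + m)
prune p = zero ∷ tail p

-- Only the parent of `suc zero` changes. A path arriving there continues at the parent of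
-- `suc (suc zero)`, whose own path avoids `suc zero` and is therefore unaffected.
graft-sibling : {p : Fin (2 + m) → Fin (3 + m)} → Normal p → Sibling (graft p)
graft-sibling {p = p} (acyclic , _ , avoids) = (λ v → graft-reach (acyclic v)) , refl
  where
  avoids⇒reach : ∀ {v} → Avoids p v → Reach (graft p) v
  avoids⇒reach root     = root
  avoids⇒reach (step a) = step (avoids⇒reach a)
  graft-reach : ∀ {v} → Reach p v → Reach (graft p) v
  graft-reach root             = root
  graft-reach (step {suc j} r) = step (graft-reach r)
  graft-reach (step {zero} _) with avoids⇒reach avoids
  ... | step r = step r

-- The common parent has a smaller key than `suc zero`, and keys decrease towards the root, so the
-- path from it never meets `suc zero`.
prune-normal : {p : Fin (2 + m) → Fin (3 + m)} → Sibling p → Normal (prune p)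
prune-normal {p = p} (acyclic , siblings) = (λ v → prune-reach (acyclic v)) , refl ,
  step (below⇒avoids (acyclic _) (subst (λ v → key v < key (suc zero)) siblings (key-parent zero)))
  where
  open BreadthFirst acyclic
  prune-reach : ∀ {v} → Reach p v → Reach (prune p) v
  prune-reach root             = root
  prune-reach (step {zero}  _) = step root
  prune-reach (step {suc j} r) = step (prune-reach r)
  below⇒avoids : ∀ {v} → Reach p v → key v < key (suc zero) → Avoids (prune p) v
  below⇒avoids root             _  = root
  below⇒avoids (step {zero}  _) lt = contradiction lt (<-irrefl refl)
  below⇒avoids (step {suc j} r) lt = step (below⇒avoids r (<-trans (key-parent (suc j)) lt))

sibling↔normal : Inverse (FunctionSetoid (Sibling {m})) (FunctionSetoid Normal)
sibling↔normal = mkInverse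
  (λ (p , s) → prune p , prune-normal s)
  (λ (p , s) → graft p , graft-sibling s)
  (λ { p≗q zero → refl ; p≗q (suc j) → p≗q (suc j) })
  (λ { p≗q zero → p≗q (suc zero) ; p≗q (suc j) → p≗q (suc j) })
  (λ { (p , _ , p₀ , _) zero → sym p₀ ; (p , _) (suc j) → refl })
  (λ { (p , _ , p₀) zero → sym p₀ ; (p , _) (suc j) → refl })

infix 4 _≋_

-- `SamePair` freed from a particular graph, so that edges of different trees can be compared.
_≋_ : {A : Set} → A × A → A × A → Set
(u , v) ≋ (u′ , v′) = (u ≡ u′ × v ≡ v′) ⊎ (u ≡ v′ × v ≡ u′)

≋-swap : {A : Set} {u v : A} {x : A × A} → (u , v) ≋ x → (v , u) ≋ x
≋-swap (inj₁ (p , q)) = inj₂ (q , p)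
≋-swap (inj₂ (p , q)) = inj₁ (q , p)

≋-sym : {A : Set} {x y : A × A} → x ≋ y → y ≋ x
≋-sym (inj₁ (refl , refl)) = inj₁ (refl , refl)
≋-sym (inj₂ (refl , refl)) = inj₂ (refl , refl)

≋-trans : {A : Set} {x y z : A × A} → x ≋ y → y ≋ z → x ≋ z
≋-trans (inj₁ (refl , refl)) y≋z = y≋z
≋-trans (inj₂ (refl , refl)) y≋z = ≋-swap y≋z

≋-map : {A B : Set} (f : A → B) {u v u′ v′ : A} → (u , v) ≋ (u′ , v′) → (f u , f v) ≋ (f u′ , f v′)
≋-map f (inj₁ (p , q)) = inj₁ (cong f p , cong f q)
≋-map f (inj₂ (p , q)) = inj₂ (cong f p , cong f q)

≋-injective : {A B : Set} {f : A → B} → Injective _≡_ _≡_ f →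
  ∀ {u v u′ v′} → (f u , f v) ≋ (f u′ , f v′) → (u , v) ≋ (u′ , v′)
≋-injective inj (inj₁ (p , q)) = inj₁ (inj p , inj q)
≋-injective inj (inj₂ (p , q)) = inj₂ (inj p , inj q)

argmax : (f : Fin (suc n) → ℕ) → ∃ λ i → ∀ j → f j ≤ f i
argmax {zero}  f = zero , λ { zero → ≤-refl }
argmax {suc n} f with argmax (f ∘ suc)
... | i , max with ≤-total (f zero) (f (suc i))
...   | inj₁ le = suc i , λ { zero → le ; (suc j) → max j }
...   | inj₂ ge = zero , λ { zero → ≤-refl ; (suc j) → ≤-trans (max j) ge }

-- The predecessor and successor of an index differ because a cycle has at least three vertices.
cycle-neighbours : ∀ {m} {G : Graph m} (C : Graph.Cycle G) → let open Graph G ; open Cycle C using (c) in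
  ∀ i → ∃₂ λ j j′ → j ≢ j′ × c i ~ c j × c i ~ c j′
cycle-neighbours {G = G} C zero =
  suc zero , fromℕ _ , (λ ()) , Graph.Cycle.step C zero , Graph.~-sym G (Graph.Cycle.close C)
cycle-neighbours {G = G} C (suc i) with view i
... | ‵fromℕ      =
  _ , zero , (λ ()) , Graph.~-sym G (Graph.Cycle.step C _) , Graph.Cycle.close C
... | ‵inject₁ i′ =
  _ , suc (suc i′) , prev≢next , Graph.~-sym G (Graph.Cycle.step C _) , Graph.Cycle.step C (suc i′)
  where
  prev≢next : inject₁ (inject₁ i′) ≢ suc (suc i′)
  prev≢next eq = ℕₚ.m≢1+n+m (toℕ i′) {1}
    (trans (sym (trans (toℕ-inject₁ _) (toℕ-inject₁ i′))) (cong toℕ eq))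

module ParentTree {p : Fin n → Fin (suc n)} (acyclic : Acyclic p) where
  open BreadthFirst acyclic using (key; key-parent)

  parent≢child : ∀ {j} → p j ≢ suc j
  parent≢child {j} eq = <-irrefl (cong key eq) (key-parent j)

  no-exchange : ∀ {i j} → suc i ≡ p j → p i ≢ suc j
  no-exchange {i} {j} eq eq′ = <-asym (key-parent i)
    (subst₂ (λ u v → key u < key v) (sym eq) (sym eq′) (key-parent j))

  edge-unique : ∀ {i j} → (suc i , p i) ≋ (suc j , p j) → i ≡ j
  edge-unique (inj₁ (eq , _))   = suc-injective eq
  edge-unique (inj₂ (eq , eq′)) = contradiction eq′ (no-exchange eq)

  graph : Graph (suc n)
  graph = record
    { _~_      = λ u v → ∃ λ j → (u , v) ≋ (suc j , p j)
    ; _~?_     = λ u v → any? λ j →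
        ((u ≟ suc j) ×-dec (v ≟ p j)) ⊎-dec ((u ≟ p j) ×-dec (v ≟ suc j))
    ; ~-sym    = λ (j , s) → j , ≋-swap s
    ; ~-irrefl = λ { refl (j , inj₁ (eq , eq′)) → parent≢child (trans (sym eq′) eq)
                   ; refl (j , inj₂ (eq , eq′)) → parent≢child (trans (sym eq) eq′) }
    }

  open Graph graph

  toRoot : ∀ {v} → Reach p v → Star _~_ v zero
  toRoot root         = ε
  toRoot (step {j} r) = (j , inj₁ (refl , refl)) ◅ toRoot r

  connected : Connected
  connected u v = toRoot (acyclic u) ◅◅ Star.reverse (λ {x} {y} → ~-sym {x} {y}) (toRoot (acyclic v))

  lower-neighbour : ∀ {u v} → u ~ v → key v ≤ key u → ∃ λ j → u ≡ suc j × v ≡ p j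
  lower-neighbour (j , inj₁ eqs)           _  = j , eqs
  lower-neighbour (j , inj₂ (refl , refl)) le = contradiction le (ℕₚ.<⇒≱ (key-parent j))

  lower-neighbour-unique : ∀ {u v w} → u ~ v → u ~ w → key v ≤ key u → key w ≤ key u → v ≡ w
  lower-neighbour-unique e e′ le le′ with lower-neighbour e le | lower-neighbour e′ le′
  ... | _ , refl , v≡ | _ , refl , w≡ = trans v≡ (sym w≡)

  -- At a vertex of maximal key on the cycle, both neighbours would have to be its parent.
  ¬cycle : ¬ Cycle
  ¬cycle C with argmax (key ∘ Cycle.c C)
  ... | i , max with cycle-neighbours C i
  ...   | j , j′ , j≢j′ , e , e′ = j≢j′ (Cycle.distinct C (lower-neighbour-unique e e′ (max j) (max j′)))

  labelling : Bijection edges (setoid (Fin n))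
  labelling = record
    { to        = λ (_ , _ , j , _) → j
    ; cong      = λ { {_ , _ , i , s} {_ , _ , j , t} eq → edge-unique (≋-trans (≋-sym s) (≋-trans eq t)) }
    ; bijective = (λ { {_ , _ , i , s} {_ , _ , .i , t} refl → ≋-trans s (≋-sym t) })
                , λ j → (suc j , p j , j , inj₁ (refl , refl)) ,
                    λ { {_ , _ , i , s} eq → edge-unique (≋-trans (≋-sym s) eq) }
    }

  tree : EdgeLabelledTree n
  tree = record { graph = graph ; isTree = connected , ¬cycle ; labelling = labelling }

open ParentTree using (tree)

module Endpoints (T : EdgeLabelledTree n) where
  open EdgeLabelledTree T
  private module L = Bijection labelling

  -- Surjectivity of the labelling supplies an arbitrary orientation of the edge, hence the later
  -- use of `_≋_`.
  endpoints : Fin n → Fin (suc n) × Fin (suc n)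
  endpoints j = let (u , v , _) , _ = L.surjective j in u , v

  label-endpoints : ∀ {u v} (e : u ~ v) → (u , v) ≋ endpoints (label e)
  label-endpoints e = let x , hits = L.surjective (label e) in
    L.injective (sym (hits {x} (inj₁ (refl , refl))))

  endpoints-label : ∀ {u v j} (e : u ~ v) → (u , v) ≋ endpoints j → label e ≡ j
  endpoints-label {j = j} e s = proj₂ (L.surjective j) {_ , _ , e} s

  endpoints-adjacent : ∀ {u v j} → (u , v) ≋ endpoints j → u ~ v
  endpoints-adjacent {j = j} s with L.surjective j | s
  ... | (_ , _ , e) , _ | inj₁ (refl , refl) = e
  ... | (_ , _ , e) , _ | inj₂ (refl , refl) = ~-sym e

open Endpoints

record Represents (p : Fin n → Fin (suc n)) (T : EdgeLabelledTree n) : Set where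
  field
    vertex : Permutation′ (suc n)
    edge   : ∀ j → (vertex ⟨$⟩ʳ suc j , vertex ⟨$⟩ʳ p j) ≋ endpoints T j

open Represents

represents⇒≅ : {p : Fin n → Fin (suc n)} (acyclic : Acyclic p) {T : EdgeLabelledTree n} →
  Represents p T → tree acyclic ≅ T
represents⇒≅ {p = p} acyclic {T} R = record
  { σ         = vertex R
  ; preserves = λ (j , s) → endpoints-adjacent T (mapped s)
  ; reflects  = λ e → T.label e , ≋-injective (permutation-injective (vertex R))
      (≋-trans (label-endpoints T e) (≋-sym (edge R (T.label e))))
  ; labels    = λ (j , s) e′ → sym (endpoints-label T e′ (mapped s))
  }
  where
  module T = EdgeLabelledTree T
  mapped : ∀ {u v j} → (u , v) ≋ (suc j , p j) → (vertex R ⟨$⟩ʳ u , vertex R ⟨$⟩ʳ v) ≋ endpoints T j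
  mapped {j = j} s = ≋-trans (≋-map (vertex R ⟨$⟩ʳ_) s) (edge R j)

-- An isomorphism maps edge `j` to edge `j`, so it can only keep or reverse each edge. Edge 1 hangs
-- on the root's side of edge 0 in both trees, which fixes the root; the remaining vertices follow
-- outwards from it.
normal-unique : {p q : Fin (2 + m) → Fin (3 + m)} →
  ((acyclic-p , _) : Normal p) ((acyclic-q , _) : Normal q) →
  tree acyclic-p ≅ tree acyclic-q → p ≗ q
normal-unique {m = m} {p} {q} (acyclic-p , p₀ , avoids-p) (acyclic-q , q₀ , avoids-q) f = parents-agree
  where
  open _≅_ f
  s : Fin (3 + m) → Fin (3 + m)
  s = σ ⟨$⟩ʳ_

  image : ∀ j → (s (suc j) , s (p j)) ≋ (suc j , q j)
  image j = subst (λ i → (s (suc j) , s (p j)) ≋ (suc i , q i))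
    (sym (labels e (preserves e))) (proj₂ (preserves e))
    where
    e : ∃ λ i → (suc j , p j) ≋ (suc i , p i)
    e = j , inj₁ (refl , refl)

  -- Deleting the edge 0 leaves the vertices avoiding suc zero as a union of components.
  avoids-across : ∀ {u v j} → (u , v) ≋ (suc (suc j) , q (suc j)) → Avoids q u → Avoids q v
  avoids-across (inj₁ (refl , refl)) = avoids-parent
  avoids-across (inj₂ (refl , refl)) = step

  avoids-image : ∀ {v} → Avoids p v → Avoids q (s v) → Avoids q (s zero)
  avoids-image root         b = b
  avoids-image (step {j} a) b = avoids-image a (avoids-across (image (suc j)) b)

  avoids-s₂ : Avoids q (s (suc (suc zero)))
  avoids-s₂ with image (suc zero)
  ... | inj₁ (eq , _) = subst (Avoids q) (sym eq) avoids-q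
  ... | inj₂ (eq , _) = subst (Avoids q) (sym eq) (avoids-parent avoids-q)

  s-root : s zero ≡ zero
  s-root with image zero
  ... | inj₁ (_ , eq) = trans (cong s (sym p₀)) (trans eq q₀)
  ... | inj₂ (_ , eq)
    -- Reversing edge 0 would put `s zero` at `suc zero`, yet `Avoids q (suc zero)` has no
    -- constructor.
    with () ← subst (Avoids q) (trans (cong s (sym p₀)) eq) (avoids-image avoids-p avoids-s₂)

  s-fixes : ∀ {v} → Reach p v → s v ≡ v
  s-fixes root         = s-root
  s-fixes (step {j} r) with image j
  ... | inj₁ (eq , _) = eq
  -- A reversed edge would send `p j` to `suc j`, but `p j` is fixed by induction.
  ... | inj₂ (_ , eq) = contradiction (trans (sym (s-fixes r)) eq) (ParentTree.parent≢child acyclic-p)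

  parents-agree : p ≗ q
  parents-agree j with image j
  ... | inj₁ (_ , eq) = trans (sym (s-fixes (acyclic-p (p j)))) eq
  ... | inj₂ (_ , eq) =
    contradiction (trans (sym (s-fixes (acyclic-p (p j)))) eq) (ParentTree.parent≢child acyclic-p)

least : {P : Pred ℕ 0ℓ} → Decidable P → ∀ k → P k → ∃ λ l → P l × (∀ i → P i → l ≤ i)
least P? k pk with P? 0
... | yes p₀ = 0 , p₀ , λ _ _ → z≤n
least P? zero    pk | no ¬p₀ = contradiction pk ¬p₀
least P? (suc k) pk | no ¬p₀ with l , pl , min ← least (P? ∘ suc) k pk =
  suc l , pl , λ { zero p₀ → contradiction p₀ ¬p₀ ; (suc i) pi → s≤s (min i pi) }

module Distance {m} (G : Graph m) (connected : Graph.Connected G) (r : Fin m) where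
  open Graph G

  Walk : ℕ → Fin m → Set
  Walk zero    v = v ≡ r
  Walk (suc k) v = ∃ λ w → v ~ w × Walk k w

  walk? : ∀ k → Decidable (Walk k)
  walk? zero    v = v ≟ r
  walk? (suc k) v = any? λ w → (v ~? w) ×-dec walk? k w

  walk : ∀ {v} → Star _~_ v r → ∃ λ k → Walk k v
  walk ε        = 0 , refl
  walk (e ◅ es) = let k , w = walk es in suc k , _ , e , w

  shortest : ∀ v → ∃ λ l → Walk l v × (∀ i → Walk i v → l ≤ i)
  shortest v = let k , w = walk (connected v r) in least (λ k → walk? k v) k w

  distance : Fin m → ℕ
  distance = proj₁ ∘ shortest

  closer : ∀ v → v ≢ r → ∃ λ w → v ~ w × distance w < distance v
  closer v v≢r with shortest v
  ... | zero  , v≡r , _ = contradiction v≡r v≢r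
  -- Dropping the first edge of a shortest walk leaves a walk of length `l` from `w`.
  ... | suc l , (w , e , walk-w) , _ = w , e , s≤s (proj₂ (proj₂ (shortest w)) l walk-w)

-- A vertex other than r is named after the label of an edge towards r.
rooted-representation : (T : EdgeLabelledTree n) (r : Fin (suc n)) →
  ∃ λ p → Acyclic p × Σ[ R ∈ Represents p T ] vertex R ⟨$⟩ʳ zero ≡ r
rooted-representation {n} T r = p , acyclic , record { vertex = ν ; edge = edge′ } , refl
  where
  open EdgeLabelledTree T
  open Distance graph (proj₁ isTree) r

  up : ∀ i → ∃ λ w → punchIn r i ~ w × distance w < distance (punchIn r i)
  up i = closer (punchIn r i) (punchInᵢ≢i r i)

  upLabel : Fin n → Fin n
  upLabel i = label (proj₁ (proj₂ (up i)))

  upLabel-injective : Injective _≡_ _≡_ upLabel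
  upLabel-injective {i} {j} eq with up i | up j | Bijection.injective labelling eq
  ... | _ | _ | inj₁ (eq₁ , _) = punchIn-injective r i j eq₁
  ... | _ , _ , lt | _ , _ , lt′ | inj₂ (eq₁ , eq₂) =
    -- One edge chosen from both its ends would make each end closer to `r` than the other.
    contradiction (subst₂ (λ u v → distance u < distance v) (sym eq₁) (sym eq₂) lt′) (<-asym lt)

  labels : Permutation′ n
  labels = injective⇒permutation upLabel upLabel-injective

  name : Fin n → Fin n
  name = labels ⟨$⟩ˡ_

  ν : Permutation′ (suc n)
  -- Sends `zero` to `r` and `suc j` to the vertex whose upward edge is labelled `j`.
  ν = Perm.insert zero r (Perm.flip labels)

  p : Fin n → Fin (suc n)
  p j = ν ⟨$⟩ˡ proj₁ (up (name j))

  edge′ : ∀ j → (ν ⟨$⟩ʳ suc j , ν ⟨$⟩ʳ p j) ≋ endpoints T j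
  edge′ j = ≋-trans (inj₁ (refl , inverseʳ ν))
    (subst (λ l → (punchIn r (name j) , proj₁ (up (name j))) ≋ endpoints T l) (inverseʳ labels)
      (label-endpoints T (proj₁ (proj₂ (up (name j))))))

  acyclic : Acyclic p
  acyclic = descent⇒acyclic (distance ∘ (ν ⟨$⟩ʳ_))
    (λ j → subst (λ v → distance v < distance (punchIn r (name j))) (sym (inverseʳ ν))
      (proj₂ (proj₂ (up (name j)))))

exchange : Permutation′ (2 + n)
exchange = Perm.swap Perm.id

-- The same tree, rooted at the other end of the edge 0.
reroot : (Fin (suc n) → Fin (2 + n)) → Fin (suc n) → Fin (2 + n)
reroot p = zero ∷ λ j → exchange ⟨$⟩ˡ p (suc j)

reroot-acyclic : {p : Fin (suc n) → Fin (2 + n)} → Acyclic p → Acyclic (reroot p)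
reroot-acyclic {p = p} acyclic v =
  subst (Reach (reroot p)) (inverseˡ exchange) (go (acyclic (exchange ⟨$⟩ʳ v)))
  where
  go : ∀ {v} → Reach p v → Reach (reroot p) (exchange ⟨$⟩ˡ v)
  go root             = step root
  go (step {zero}  _) = root
  go (step {suc j} r) = step (go r)

-- If the path meets `suc zero`, its part up to there misses the old root, and `exchange` turns that
-- part into a path to the new root that misses `suc zero`.
avoids-or-reroot-avoids : {p : Fin (suc n) → Fin (2 + n)} → ∀ {v} → Reach p v →
  Avoids p v ⊎ Avoids (reroot p) (exchange ⟨$⟩ˡ v)
avoids-or-reroot-avoids root             = inj₁ root
avoids-or-reroot-avoids (step {zero}  _) = inj₂ root
avoids-or-reroot-avoids (step {suc j} r) = Sum.map step step (avoids-or-reroot-avoids r)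

reroot-represents : {p : Fin (suc n) → Fin (2 + n)} {T : EdgeLabelledTree (suc n)} → p zero ≡ zero →
  Represents p T → Represents (reroot p) T
reroot-represents {p = p} {T} p₀ R = record { vertex = exchange Perm.∘ₚ vertex R ; edge = edge′ }
  where
  ν = vertex R ⟨$⟩ʳ_
  edge′ : ∀ j → (ν (exchange ⟨$⟩ʳ suc j) , ν (exchange ⟨$⟩ʳ reroot p j)) ≋ endpoints T j
  edge′ zero    = ≋-trans (inj₂ (cong ν (sym p₀) , refl)) (edge R zero)
  edge′ (suc j) = ≋-trans (inj₁ (refl , cong ν (inverseʳ exchange))) (edge R (suc j))

-- Rooting at an arbitrary end of edge 0 already forces `p zero ≡ zero`; if this end is the one
-- farther from edge 1, rerooting moves to the other.
normalise : {T : EdgeLabelledTree (2 + m)} {p : Fin (2 + m) → Fin (3 + m)} → Acyclic p →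
  (R : Represents p T) → vertex R ⟨$⟩ʳ zero ≡ proj₁ (endpoints T zero) →
  ∃ λ q → Normal q × Represents q T
normalise {m} {T} {p} acyclic R ν₀ = choose (avoids-or-reroot-avoids (acyclic (suc (suc zero))))
  where
  root-parent : (vertex R ⟨$⟩ʳ suc zero , vertex R ⟨$⟩ʳ p zero) ≋ endpoints T zero → p zero ≡ zero
  root-parent (inj₁ (eq , _)) = contradiction (permutation-injective (vertex R) (trans eq (sym ν₀))) λ ()
  root-parent (inj₂ (_ , eq)) = permutation-injective (vertex R) (trans eq (sym ν₀))

  p₀ : p zero ≡ zero
  p₀ = root-parent (edge R zero)

  choose : Avoids p (suc (suc zero)) ⊎ Avoids (reroot p) (suc (suc zero)) → ∃ λ q → Normal q × Represents q T
  choose (inj₁ avoids) = p , (acyclic , p₀ , avoids) , R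
  choose (inj₂ avoids) = reroot p , (reroot-acyclic acyclic , refl , avoids) , reroot-represents p₀ R

normal-representation : (T : EdgeLabelledTree (2 + m)) → ∃ λ p → Normal p × Represents p T
normal-representation T =
  let _ , acyclic , R , ν₀ = rooted-representation T (proj₁ (endpoints T zero)) in normalise acyclic R ν₀

-- The choices made in `code` are harmless: `normal-unique` makes it respect isomorphism and also
-- invert `tree`.
normal↔tree : Inverse (FunctionSetoid (Normal {m})) (UnlabelledVertexTrees (2 + m))
normal↔tree = mkInverse
  (λ (_ , acyclic , _) → tree acyclic)
  code
  (λ {(p , acyclic-p , _)} {(q , acyclic-q , _)} p≗q → represents⇒≅ acyclic-p {tree acyclic-q} (record
     { vertex = Perm.id
     ; edge   = λ j → ≋-trans (inj₁ (refl , p≗q j)) (label-endpoints (tree acyclic-q) (j , inj₁ (refl , refl))) }))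
  (λ {S} {T} S≅T → normal-unique (proj₂ (code S)) (proj₂ (code T))
     (≅-trans (code-≅ S) (≅-trans S≅T (≅-sym (code-≅ T)))))
  code-≅
  (λ (p , normal) → normal-unique (proj₂ (code (tree (proj₁ normal)))) normal (code-≅ (tree (proj₁ normal))))
  where
  code : EdgeLabelledTree (2 + m) → ∃ Normal
  code T = let p , normal , _ = normal-representation T in p , normal
  code-≅ : (T : EdgeLabelledTree (2 + m)) → tree (proj₁ (proj₂ (code T))) ≅ T
  code-≅ T = let p , normal , R = normal-representation T in represents⇒≅ (proj₁ normal) R

theorem2 : ∀ (n : ℕ) (2≤n : 2 ≤ n) →
    ∃₂ λ (eqₙ UTₙ : ℕ) →
    HasCardinality (EqParkingFunctions n 2≤n) eqₙ ×
    HasCardinality (UnlabelledVertexTrees n) UTₙ ×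
    eqₙ ≡ UTₙ
theorem2 _ (s≤s (s≤s z≤n)) = _ , _ , parking↔Fin ,
  -- Trees are counted by transporting the enumeration of parking functions, so both cardinalities
  -- are the same number.
  Composition.inverse (Symmetry.inverse parking↔tree) parking↔Fin , refl
  where
  parking↔tree = Composition.inverse (parking↔siblings zero (suc zero)) (Composition.inverse sibling↔normal normal↔tree)
  parking↔Fin = proj₂ (decidable-functions-finite
    (λ f≗g (pf , eq) → IsParkingFunction-resp f≗g pf , trans (sym (f≗g zero)) (trans eq (f≗g (suc zero))))
    (λ a → map′ Parks⇒IsParkingFunction IsParkingFunction⇒Parks (parks? a) ×-dec (a zero ≟ a (suc zero))))
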